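{- Let $P$ be a partial monoid, let $R$ be the semi-Thue system on $P^*$ associated with $P$, and let $\mathrm{Irr}(P)$ be the set of $R$-irreducible words. The left standard reduction $\mathrm{lstd}(R)$ is a terminating and confluent abstract rewriting system on $P^*$, and its set of irreducible elements is exactly $\mathrm{Irr}(P)$. Consequently, every $w\in P^*$ has one and only one normal form $w'\in\mathrm{Irr}(P)$ with respect to $\mathrm{lstd}(R)$, and this $w'$ is also a normal form of $w$ with respect to $R$ (i.e. $w\Rightarrow_R^* w'$ and $w'$ is $R$-irreducible).
   Context: A partial monoid is a nonempty set $P$ with a partial function $\times:P\times P\to P$ with domain $\mathrm{dom}(\times)\subseteq P\times P$ and an element $1_P\in P$ such that: (1) for every $x\in P$, $(x,1_P),(1_P,x)\in\mathrm{dom}(\times)$ and $x\times 1_P=x=1_P\times x$; (2) for all $x,y,z\in P$, [$(x,y)\in\mathrm{dom}(\times)$ and $(x\times y,z)\in\mathrm{dom}(\times)$] if and only if [$(y,z)\in\mathrm{dom}(\times)$ and $(x,y\times z)\in\mathrm{dom}(\times)$], and in this case $(x\times y)\times z=x\times(y\times z)$. $P^*$ is the free monoid of words over the alphabet $P$, $\epsilon$ is the empty word, and $i_P:P\hookrightarrow P^*$ sends $x$ to the one-letter word $x$. The semi-Thue system associated with $P$ is $R=\{(i_P(x)i_P(y),\,i_P(x\times y)):(x,y)\in\mathrm{dom}(\times)\}\cup\{(i_P(1_P),\epsilon)\}$. Its one-step reduction is: $uav\Rightarrow_R ubv$ for $u,v\in P^*$, $(a,b)\in R$; $\Rightarrow_R^*$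 is the reflexive-transitive closure. $\mathrm{Irr}(P)$ is the set of words to which no $\Rightarrow_R$ step applies, i.e. words $i_P(x_1)\cdots i_P(x_n)$, $n\ge 0$, with all $x_i\neq 1_P$ and $(x_i,x_{i+1})\notin\mathrm{dom}(\times)$ for $1\le i<n$. An abstract rewriting system $(S,\Rightarrow)$ is a set with a binary relation; it is terminating if there is no infinite chain $a_0\Rightarrow a_1\Rightarrow\cdots$; confluent if whenever $a\Rightarrow^* b$ and $a\Rightarrow^* c$ there is $d$ with $b\Rightarrow^* d$ and $c\Rightarrow^* d$; $a$ is irreducible if there is no $b$ with $a\Rightarrow b$; a normal form of $a$ is an irreducible $b$ with $a\Rightarrow^* b$. For $w\in(P\setminus\{1_P\})^*\setminus\mathrm{Irr}(P)$, let $w_m$ be the longest prefix of $w$ lying in $\mathrm{Irr}(P)$; there is a unique $(u,x,y,v)$ with $u,v\in(P\setminus\{1_P\})^*$, $x,y\in P\setminus\{1_P\}$, $w_m=u\,i_P(x)$, $w=u\,i_P(x)i_P(y)v$, $(x,y)\in\mathrm{dom}(\times)$; this is the left-standard decomposition of $w$. If $x\times y=1_P$ then $u=\epsilon$. The left standard reduction $\mathrm{lstd}(R)$ is the binary relation on $P^*$ consisting of: the steps $u\,i_P(1_P)\,v\to uv$ ($u,v\in P^*$); and, for $w\in(P\setminus\{1_P\})^*\setminus\mathrm{Irr}(P)$ with left-standard decomposition $(u,x,y,v)$, the step $w\to v$ if $x\times y=1_P$ and the step $w\to u\,i_P(x\times y)\,v$ if $x\times y\ne 1_P$. -}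

module Defs where

open import Level using (Level; _⊔_; suc)
open import Data.List.Base using (List; []; _∷_; [_]; _++_; _∷ʳ_; length)
open import Data.List.Relation.Binary.Prefix.Heterogeneous using (Prefix)
open import Data.List.Relation.Unary.All using (All)
open import Data.Nat.Base using (ℕ; _≤_)
open import Data.Product.Base using (Σ; ∃; _×_)
open import Function.Base using (flip)
open import Function.Bundles using (_⇔_)
open import Induction.InfiniteDescent using (InfiniteDescendingSequence)
open import Relation.Binary.Construct.Closure.ReflexiveTransitive using (Star)
open import Relation.Binary.Core using (Rel)
open import Relation.Binary.PropositionalEquality.Core using (_≡_; _≢_)
open import Relation.Binary.Rewriting using (IsNormalForm)
open import Relation.Nullary.Negation.Core using (¬_)

module _ {a r : Level} {A : Set a} (_⟶_ : Rel A r) where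

  Terminating : Set (a ⊔ r)
  Terminating = ¬ (∃ λ (f : ℕ → A) → InfiniteDescendingSequence (flip _⟶_) f)

  -- NormalFormOf x y: y is a normal form of x.
  NormalFormOf : Rel A (a ⊔ r)
  NormalFormOf x y = IsNormalForm _⟶_ y × Star _⟶_ x y

record PartialMonoid (c ℓ : Level) : Set (suc (c ⊔ ℓ)) where
  field
    Carrier : Set c
    Dom     : Rel Carrier ℓ
    mul     : ∀ x y → Dom x y → Carrier
    -- Dom need not be proof-irrelevant, so this is what makes mul a partial
    -- function of the pair (x , y) alone.
    mul-unique : ∀ {x y} (d d′ : Dom x y) → mul x y d ≡ mul x y d′
    1#      : Carrier

    identityˡ-dom : ∀ x → Dom 1# x
    identityʳ-dom : ∀ x → Dom x 1#
    identityˡ     : ∀ x → mul 1# x (identityˡ-dom x) ≡ x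
    identityʳ     : ∀ x → mul x 1# (identityʳ-dom x) ≡ x

    assoc-dom : ∀ x y z →
      Σ (Dom x y) (λ d → Dom (mul x y d) z) ⇔
      Σ (Dom y z) (λ e → Dom x (mul y z e))
    assoc : ∀ {x y z}
      (d : Dom x y) (d′ : Dom (mul x y d) z)
      (e : Dom y z) (e′ : Dom x (mul y z e)) →
      mul (mul x y d) z d′ ≡ mul x (mul y z e) e′

module Reduction {c ℓ : Level} (P : PartialMonoid c ℓ) where
  open PartialMonoid P

  Word : Set c
  Word = List Carrier

  data Rule : Rel Word (c ⊔ ℓ) where
    product : ∀ {x y} (d : Dom x y) → Rule (x ∷ y ∷ []) [ mul x y d ]
    unit    : Rule [ 1# ] []

  infix 4 _⇒_ _⇒ₗ_

  data _⇒_ : Rel Word (c ⊔ ℓ) where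
    step : ∀ u {s t} v → Rule s t → u ++ s ++ v ⇒ u ++ t ++ v

  Irr : Word → Set (c ⊔ ℓ)
  Irr = IsNormalForm _⇒_

  record LongestIrrPrefix (p w : Word) : Set (c ⊔ ℓ) where
    field
      prefix  : Prefix _≡_ p w
      irr     : Irr p
      longest : ∀ {q} → Prefix _≡_ q w → Irr q → length q ≤ length p

  -- (u , x , y , v) is the left-standard decomposition of w. Since no letter
  -- of w is 1#, the same holds of u, x, y and v.
  record LeftStandard (w u : Word) (x y : Carrier) (v : Word) : Set (c ⊔ ℓ) where
    field
      nonUnit   : All (_≢ 1#) w
      reducible : ¬ Irr w
      maximal   : LongestIrrPrefix (u ∷ʳ x) w
      split     : w ≡ u ++ x ∷ y ∷ v
      defined   : Dom x y

  -- In product-unit the prefix u is dropped from the result; it is in fact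
  -- empty: if u ended in z, then Dom z 1# and mul x y defined ≡ 1# would give
  -- Dom z x, contradicting the irreducibility of u ∷ʳ x.
  data _⇒ₗ_ : Rel Word (c ⊔ ℓ) where
    unit : ∀ u v → u ++ 1# ∷ v ⇒ₗ u ++ v
    product-unit : ∀ {w u x y v} (D : LeftStandard w u x y v) →
      mul x y (LeftStandard.defined D) ≡ 1# → w ⇒ₗ v
    product-nonUnit : ∀ {w u x y v} (D : LeftStandard w u x y v) →
      mul x y (LeftStandard.defined D) ≢ 1# →
      w ⇒ₗ u ++ mul x y (LeftStandard.defined D) ∷ v

{-# OPTIONS --safe #-}

-- Every left standard step is a sequence of R-steps and shortens the word. A
-- word containing 1# admits only deletions of 1#, which commute with one
-- another; any other word admits at most one left standard step, since its
-- longest irreducible prefix is unique. So the reduction is locally confluent,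
-- and Newman's lemma applies. A word without 1# that is not R-irreducible has
-- a leftmost pair (x , y) in Dom, and the prefix ending in x is then the
-- longest irreducible one; hence a word without left standard steps is
-- R-irreducible.

module Submission where

open import Defs
open import Level using (Level; _⊔_)
open import Axiom.ExcludedMiddle using (ExcludedMiddle)
open import Data.Product using (∃!; _×_)
open import Function.Bundles using (_⇔_)
open import Relation.Binary.PropositionalEquality.Core using (_≡_)
open import Relation.Binary.Rewriting using (Confluent; IsNormalForm)

open import Data.Empty using (⊥-elim)
open import Data.List.Base using (List; []; _∷_; [_]; _++_; _∷ʳ_; length; initLast; _∷ʳ′_)
open import Data.List.Membership.Propositional.Properties using (∈-∃++)
open import Data.List.Properties
  using (++-cancelˡ; ∷-injective; ∷-injectiveʳ; ∷ʳ-injective; ∷ʳ-++; length-++-sucʳ; length-++-≤ʳ)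
open import Data.List.Relation.Binary.Prefix.Heterogeneous using (Prefix; []; _∷_)
open import Data.List.Relation.Unary.All as All using (All; []; _∷_)
open import Data.List.Relation.Unary.All.Properties using (++⁻ʳ)
open import Data.Nat.Base using (suc; _≤_; _<_; z≤n; s≤s)
open import Data.Nat.Induction using (<-wellFounded)
open import Data.Nat.Properties
  using (≤-antisym; ≤-trans; ≤-reflexive; n≤1+n; <-trans; suc-injective)
open import Data.Product.Base using (∃; ∃₂; _,_; proj₁)
open import Data.Sum.Base using (_⊎_; inj₁; inj₂)
open import Function.Base using (flip; id; _∘_)
open import Function.Bundles using (mk⇔; Equivalence)
open import Induction.InfiniteDescent using (InfiniteDescendingSequence)
open import Induction.WellFounded using (WellFounded; Acc; acc; module Subrelation)
open import Relation.Binary.Construct.Closure.ReflexiveTransitive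
  using (Star; ε; _◅_; kleisliStar; return)
open import Relation.Binary.Construct.Closure.Transitive using (Plus; _∼⁺⟨_⟩_)
import Relation.Binary.Construct.On as On
open import Relation.Binary.Core using (Rel)
open import Relation.Binary.PropositionalEquality.Core
  using (_≢_; refl; sym; trans; cong; subst)
open import Relation.Binary.Rewriting
  using (WeaklyConfluent; WeaklyNormalizing; HasNormalForm; sn&wcr⇒cr)
open import Relation.Nullary.Decidable.Core using (yes; no)
open import Relation.Nullary.Negation.Core using (¬_; contradiction)

-- Prefixes and the deletion of one letter.

module _ {ℓ} {A : Set ℓ} where

  prefix-unique : ∀ {p q w : List A} → Prefix _≡_ p w → Prefix _≡_ q w →
    length p ≡ length q → p ≡ q
  prefix-unique []         []         _  = refl
  prefix-unique (refl ∷ p) (refl ∷ q) eq =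
    cong (_ ∷_) (prefix-unique p q (suc-injective eq))

  -- Inductive form of passing from `u ++ a ∷ v` to `u ++ v`: two deletions from one word can be
  -- compared by pattern matching, with no equation between concatenations to solve.
  data Delete (a : A) : Rel (List A) ℓ where
    here  : ∀ {w} → Delete a (a ∷ w) w
    there : ∀ {x w w′} → Delete a w w′ → Delete a (x ∷ w) (x ∷ w′)

  delete : ∀ {a} u v → Delete a (u ++ a ∷ v) (u ++ v)
  delete []      v = here
  delete (_ ∷ u) v = there (delete u v)

  delete-split : ∀ {a w w′} → Delete a w w′ →
    ∃₂ λ u v → w ≡ u ++ a ∷ v × w′ ≡ u ++ v
  delete-split here = [] , _ , refl , refl
  delete-split (there d) with u , v , refl , refl ← delete-split d =
    _ ∷ u , v , refl , refl

  delete-diamond : ∀ {a w w₁ w₂} → Delete a w w₁ → Delete a w w₂ →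
    w₁ ≡ w₂ ⊎ ∃ λ w₃ → Delete a w₁ w₃ × Delete a w₂ w₃
  delete-diamond here      here       = inj₁ refl
  delete-diamond here      (there d₂) = inj₂ (_ , d₂ , here)
  delete-diamond (there d) here       = inj₂ (_ , here , d)
  delete-diamond (there d₁) (there d₂) with delete-diamond d₁ d₂
  ... | inj₁ refl           = inj₁ refl
  ... | inj₂ (_ , d₃ , d₄)  = inj₂ (_ , there d₃ , there d₄)

-- Abstract rewriting.

module _ {a r} {A : Set a} {_⟶_ : Rel A r} where

  wf⇒terminating : WellFounded (flip _⟶_) → Terminating _⟶_
  wf⇒terminating wf (f , f↓) = finite (wf _) f f↓ refl
    where
    -- The start of the sequence is tied to `x` by an equation, so that the recursion on
    -- accessibility can pass from `f` to its tail.
    finite : ∀ {x} → Acc (flip _⟶_) x →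
      ∀ f → InfiniteDescendingSequence (flip _⟶_) f → f 0 ≢ x
    finite (acc rs) f f↓ refl = finite (rs (f↓ 0)) (f ∘ suc) (f↓ ∘ suc) refl

  wf⇒weaklyNormalizing : ExcludedMiddle (a ⊔ r) →
    WellFounded (flip _⟶_) → WeaklyNormalizing _⟶_
  wf⇒weaklyNormalizing em wf x = normalize (wf x)
    where
    normalize : ∀ {x} → Acc (flip _⟶_) x → HasNormalForm _⟶_ x
    -- Excluded middle decides whether `x` can be reduced at all.
    normalize {x} (acc rs) with em {∃ λ y → x ⟶ y}
    ... | no  nf      = x , nf , ε
    ... | yes (_ , s) with y , nf , ss ← normalize (rs s) = y , nf , s ◅ ss

  confluent⇒normalForm-unique : Confluent _⟶_ →
    ∀ {x y z} → NormalFormOf _⟶_ x y → NormalFormOf _⟶_ x z → y ≡ z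
  confluent⇒normalForm-unique conf (nf-y , x↠y) (nf-z , x↠z)
    with conf x↠y x↠z
  ... | _ , ε     , ε     = refl
  ... | _ , s ◅ _ , _     = contradiction (_ , s) nf-y
  ... | _ , ε     , s ◅ _ = contradiction (_ , s) nf-z

module _ {c ℓ} (P : PartialMonoid c ℓ) where
  open PartialMonoid P
  open Reduction P
  open LeftStandard
  open LongestIrrPrefix

  -- Irreducible words.

  irr-[] : Irr []
  irr-[] (_ , st) = irreducible st refl
    where
    -- The source of a step is a concatenation that computes only once its left context is split, so
    -- it is compared with `[]` by an equation.
    irreducible : ∀ {w b} → w ⇒ b → w ≢ []
    irreducible (step []      _ (product _)) ()
    irreducible (step []      _ unit)        ()
    irreducible (step (_ ∷ _) _ _)           ()

  -- A redex either begins at `x`, which the first two hypotheses exclude, or lies inside `w`.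
  irr-∷ : ∀ {x w} → x ≢ 1# → (∀ {y v} → w ≡ y ∷ v → ¬ Dom x y) → Irr w → Irr (x ∷ w)
  irr-∷ {x} {w} x≢1 ¬dom irr-w (_ , st) = irreducible st refl
    where
    irreducible : ∀ {w′ b} → w′ ⇒ b → w′ ≢ x ∷ w
    irreducible (step []      _ (product d)) refl = ¬dom refl d
    irreducible (step []      _ unit)        refl = x≢1 refl
    irreducible (step (_ ∷ u) v r)           eq   =
      irr-w (_ , subst (_⇒ _) (∷-injectiveʳ eq) (step u v r))

  irr-tail : ∀ {x w} → Irr (x ∷ w) → Irr w
  irr-tail irr-xw (_ , step u v r) = irr-xw (_ , step (_ ∷ u) v r)

  -- A prefix reaching beyond `x` contains the redex formed by `x` and `y`.
  irr-length-≤ : ∀ u {x y v q} → Dom x y →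
    Prefix _≡_ q (u ++ x ∷ y ∷ v) → Irr q → length q ≤ length (u ∷ʳ x)
  irr-length-≤ []      d []                irr-q = z≤n
  irr-length-≤ []      d (refl ∷ [])       irr-q = s≤s z≤n
  irr-length-≤ []      d (refl ∷ refl ∷ _) irr-q =
    contradiction (_ , step [] _ (product d)) irr-q
  irr-length-≤ (_ ∷ u) d []                irr-q = z≤n
  irr-length-≤ (_ ∷ u) d (refl ∷ pre)      irr-q =
    s≤s (irr-length-≤ u d pre (irr-tail irr-q))

  ∷ʳ-prefix : ∀ u {x : Carrier} {v} → Prefix _≡_ (u ∷ʳ x) (u ++ x ∷ v)
  ∷ʳ-prefix []      = refl ∷ []
  ∷ʳ-prefix (_ ∷ u) = refl ∷ ∷ʳ-prefix u

  -- Left-standard decompositions.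

  leftStandard : ∀ {u x y v} → All (_≢ 1#) (u ++ x ∷ y ∷ v) →
    Irr (u ∷ʳ x) → Dom x y → LeftStandard (u ++ x ∷ y ∷ v) u x y v
  leftStandard {u} {v = v} nu irr-ux d = record
    { nonUnit   = nu
    ; reducible = λ irr-w → irr-w (_ , step u v (product d))
    ; maximal   = record
      { prefix  = ∷ʳ-prefix u
      ; irr     = irr-ux
      ; longest = irr-length-≤ u d
      }
    ; split     = refl
    ; defined   = d
    }

  longestIrrPrefix-unique : ∀ {w p q} →
    LongestIrrPrefix p w → LongestIrrPrefix q w → p ≡ q
  longestIrrPrefix-unique M N = prefix-unique (prefix M) (prefix N)
    (≤-antisym (longest N (prefix M) (irr M)) (longest M (prefix N) (irr N)))

  -- The longest irreducible prefix determines `u` and `x`; cancelling it from `w` leaves `y` and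
  -- `v`. Only the words and letters are compared, since proofs of `Dom` may differ.
  leftStandard-unique : ∀ {w u x y v u′ x′ y′ v′} →
    LeftStandard w u x y v → LeftStandard w u′ x′ y′ v′ →
    (u , x , y , v) ≡ (u′ , x′ , y′ , v′)
  leftStandard-unique {u = u} {u′ = u′} D D′
    with refl , refl ← ∷ʳ-injective u u′
           (longestIrrPrefix-unique (maximal D) (maximal D′))
    with refl , eq   ← ∷-injective (++-cancelˡ u _ _ (trans (sym (split D)) (split D′)))
    with refl , refl ← ∷-injective eq
    = refl

  product-unit-prefix : ∀ {w u x y v} (D : LeftStandard w u x y v) →
    mul x y (defined D) ≡ 1# → u ≡ []
  product-unit-prefix {u = u} {x} {y} D xy≡1 with initLast u
  ... | []       = refl
  ... | us ∷ʳ′ z = contradiction (_ , step us [] (product (proj₁ zx-y)))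
                     (subst Irr (∷ʳ-++ us z [ x ]) (irr (maximal D)))
    where
    zx-y : ∃ λ d → Dom (mul z x d) y
    zx-y = Equivalence.from (assoc-dom z x y)
      (defined D , subst (Dom z) (sym xy≡1) (identityʳ-dom z))

  -- Termination.

  ⇒ₗ-shortens : ∀ {w w′} → w ⇒ₗ w′ → length w′ < length w
  ⇒ₗ-shortens (unit u v) = ≤-reflexive (sym (length-++-sucʳ u 1# v))
  ⇒ₗ-shortens (product-unit {u = u} {x} {y} {v} D _) =
    -- Both `x` and `y` disappear, one letter more than a strict decrease requires.
    ≤-trans (n≤1+n _)
      (≤-trans (length-++-≤ʳ (x ∷ y ∷ v) {u})
        (≤-reflexive (cong length (sym (split D)))))
  ⇒ₗ-shortens (product-nonUnit {u = u} {x} {y} {v} D _) =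
    ≤-reflexive (trans (cong suc (length-++-sucʳ u _ v))
      (sym (trans (cong length (split D))
        (trans (length-++-sucʳ u x (y ∷ v)) (cong suc (length-++-sucʳ u y v))))))

  ⇒ₗ⁺-shortens : ∀ {w w′} → Plus _⇒ₗ_ w w′ → length w′ < length w
  ⇒ₗ⁺-shortens Plus.[ s ]        = ⇒ₗ-shortens s
  ⇒ₗ⁺-shortens (_ ∼⁺⟨ s₁ ⟩ s₂)   = <-trans (⇒ₗ⁺-shortens s₂) (⇒ₗ⁺-shortens s₁)

  -- This is the form of termination in which Newman's lemma is applied.
  ⇒ₗ⁺-wellFounded : WellFounded (flip (Plus _⇒ₗ_))
  ⇒ₗ⁺-wellFounded =
    Subrelation.wellFounded ⇒ₗ⁺-shortens (On.wellFounded length <-wellFounded)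

  ⇒ₗ-wellFounded : WellFounded (flip _⇒ₗ_)
  ⇒ₗ-wellFounded =
    Subrelation.wellFounded ⇒ₗ-shortens (On.wellFounded length <-wellFounded)

  -- Local confluence.

  delete⇒ₗ : ∀ {w w′} → Delete 1# w w′ → w ⇒ₗ w′
  delete⇒ₗ d with u , v , refl , refl ← delete-split d = unit u v

  leftStandard⇒¬unit : ∀ {u v u′ x y v′} → ¬ LeftStandard (u ++ 1# ∷ v) u′ x y v′
  leftStandard⇒¬unit {u} D with 1≢1 ∷ _ ← ++⁻ʳ u (nonUnit D) = 1≢1 refl

  -- Stating one side with `Delete` avoids unifying two splittings of the same word around `1#`.
  delete-peak : ∀ {w w₁ w₂} → Delete 1# w w₁ → w ⇒ₗ w₂ →
    ∃ λ w₃ → Star _⇒ₗ_ w₁ w₃ × Star _⇒ₗ_ w₂ w₃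
  delete-peak d (unit u v) with delete-diamond d (delete u v)
  ... | inj₁ refl          = _ , ε , ε
  ... | inj₂ (_ , d₁ , d₂) = _ , return (delete⇒ₗ d₁) , return (delete⇒ₗ d₂)
  delete-peak d (product-unit D _) with u , _ , refl , _ ← delete-split d =
    ⊥-elim (leftStandard⇒¬unit {u} D)
  delete-peak d (product-nonUnit D _) with u , _ , refl , _ ← delete-split d =
    ⊥-elim (leftStandard⇒¬unit {u} D)

  ⇒ₗ-weaklyConfluent : WeaklyConfluent _⇒ₗ_
  ⇒ₗ-weaklyConfluent (unit u v) s = delete-peak (delete u v) s
  ⇒ₗ-weaklyConfluent (product-unit D _) (unit u v) = ⊥-elim (leftStandard⇒¬unit {u} D)
  ⇒ₗ-weaklyConfluent (product-nonUnit D _) (unit u v) = ⊥-elim (leftStandard⇒¬unit {u} D)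
  ⇒ₗ-weaklyConfluent (product-unit D _) (product-unit D′ _)
    with refl ← leftStandard-unique D D′ = _ , ε , ε
  -- Both steps contract the same pair, whose product does not depend on the proof of `Dom`; it
  -- cannot both equal `1#` and differ from it.
  ⇒ₗ-weaklyConfluent (product-unit D xy≡1) (product-nonUnit D′ xy≢1)
    with refl ← leftStandard-unique D D′ =
    contradiction (trans (mul-unique (defined D′) (defined D)) xy≡1) xy≢1
  ⇒ₗ-weaklyConfluent (product-nonUnit D xy≢1) (product-unit D′ xy≡1)
    with refl ← leftStandard-unique D D′ =
    contradiction (trans (mul-unique (defined D) (defined D′)) xy≡1) xy≢1
  ⇒ₗ-weaklyConfluent (product-nonUnit D _) (product-nonUnit D′ _)
    with refl ← leftStandard-unique D D′
    rewrite mul-unique (defined D) (defined D′) = _ , ε , ε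

  ⇒ₗ-confluent : Confluent _⇒ₗ_
  ⇒ₗ-confluent = sn&wcr⇒cr ⇒ₗ⁺-wellFounded ⇒ₗ-weaklyConfluent

  -- Normal forms of the two reductions.

  no-leftmost-redex⇒irr : ∀ {w} → All (_≢ 1#) w →
    (∀ u {x y v} → w ≡ u ++ x ∷ y ∷ v → Irr (u ∷ʳ x) → ¬ Dom x y) → Irr w
  no-leftmost-redex⇒irr []               _    = irr-[]
  no-leftmost-redex⇒irr (x≢1 ∷ [])       _    = irr-∷ x≢1 (λ ()) irr-[]
  no-leftmost-redex⇒irr {x ∷ y ∷ v} (x≢1 ∷ nu) none =
    irr-∷ x≢1 (λ { refl → ¬dom }) (no-leftmost-redex⇒irr nu none-tail)
    where
    ¬dom : ¬ Dom x y
    ¬dom = none [] refl (irr-∷ x≢1 (λ ()) irr-[])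

    -- As `x` and `y` do not multiply, putting `x` in front keeps a prefix of the tail irreducible,
    -- so the hypothesis passes to the tail. The split on `u` exposes `y` as the first letter of
    -- that prefix.
    none-tail : ∀ u {x′ y′ v′} → y ∷ v ≡ u ++ x′ ∷ y′ ∷ v′ →
      Irr (u ∷ʳ x′) → ¬ Dom x′ y′
    none-tail []      refl irr-u =
      none [ x ] refl (irr-∷ x≢1 (λ { refl → ¬dom }) irr-u)
    none-tail (_ ∷ u) refl irr-u =
      none (x ∷ y ∷ u) refl (irr-∷ x≢1 (λ { refl → ¬dom }) irr-u)

  normalₗ⇒nonUnit : ∀ {w} → IsNormalForm _⇒ₗ_ w → All (_≢ 1#) w
  normalₗ⇒nonUnit nf = All.tabulate λ where
    x∈w refl → let u , v , w≡ = ∈-∃++ x∈w in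
      nf (_ , subst (_⇒ₗ u ++ v) (sym w≡) (unit u v))

  normalₗ⇒irr : ∀ {w} → IsNormalForm _⇒ₗ_ w → Irr w
  normalₗ⇒irr nf = no-leftmost-redex⇒irr (normalₗ⇒nonUnit nf) λ where
    u refl irr-ux d → let D = leftStandard (normalₗ⇒nonUnit nf) irr-ux d in
      -- Normality itself supplies the premise that the product differs from `1#`: otherwise a
      -- `product-unit` step would apply.
      nf (_ , product-nonUnit D λ xy≡1 → nf (_ , product-unit D xy≡1))

  irr⇒normalₗ : ∀ {w} → Irr w → IsNormalForm _⇒ₗ_ w
  irr⇒normalₗ irr-w (_ , unit u v)            = irr-w (_ , step u v unit)
  irr⇒normalₗ irr-w (_ , product-unit D _)    = reducible D irr-w
  irr⇒normalₗ irr-w (_ , product-nonUnit D _) = reducible D irr-w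

  -- Simulation by the semi-Thue system.

  ⇒ₗ⊆⇒* : ∀ {w w′} → w ⇒ₗ w′ → Star _⇒_ w w′
  ⇒ₗ⊆⇒* (unit u v) = return (step u v unit)
  ⇒ₗ⊆⇒* (product-unit {v = v} D xy≡1) with refl ← product-unit-prefix D xy≡1 =
    subst (λ w → Star _⇒_ w v) (sym (split D))
      -- With `u` empty, two steps suffice: contract `x` and `y` to `1#`, then erase it.
      (step [] v (product (defined D)) ◅
       subst (λ z → Star _⇒_ (z ∷ v) v) (sym xy≡1) (return (step [] v unit)))
  ⇒ₗ⊆⇒* (product-nonUnit {u = u} {v = v} D _) =
    subst (λ w → Star _⇒_ w _) (sym (split D))
      (return (step u v (product (defined D))))

mainTheorem5 : ∀ {c ℓ : Level} → ExcludedMiddle (c ⊔ ℓ) →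
    (P : PartialMonoid c ℓ) → let open Reduction P in
    Terminating _⇒ₗ_
    × Confluent _⇒ₗ_
    × (∀ w → IsNormalForm _⇒ₗ_ w ⇔ Irr w)
    × (∀ w → ∃! _≡_ (λ w′ → Irr w′ × NormalFormOf _⇒ₗ_ w w′))
    × (∀ w w′ → NormalFormOf _⇒ₗ_ w w′ → Irr w′ × NormalFormOf _⇒_ w w′)
mainTheorem5 em P =
    wf⇒terminating (⇒ₗ-wellFounded P)
  , ⇒ₗ-confluent P
  , (λ w → mk⇔ (normalₗ⇒irr P) (irr⇒normalₗ P))
  , (λ w → let w′ , nf , w↠w′ = wf⇒weaklyNormalizing em (⇒ₗ-wellFounded P) w in
      w′ , (normalₗ⇒irr P nf , nf , w↠w′) ,
      λ (_ , nfOf) → confluent⇒normalForm-unique (⇒ₗ-confluent P) (nf , w↠w′) nfOf)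
  , (λ w w′ (nf , w↠w′) →
      normalₗ⇒irr P nf , normalₗ⇒irr P nf , kleisliStar id (⇒ₗ⊆⇒* P) w↠w′)
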